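{- Let $G$ be a finite abstract simplicial complex. Then $$\sum_{x \in G} w(x)\, w(S(x)) = 0.$$
   Context: A finite abstract simplicial complex $G$ is a finite set of non-empty finite sets such that every non-empty subset of an element of $G$ is again in $G$. For $x\in G$, $w(x)=(-1)^{|x|-1}$, and for $A\subset G$, $w(A)=\sum_{y\in A}w(y)$. $G$ carries the finite topology whose basis consists of the stars $U(x)=\{y\in G : x\subset y\}$. The unit ball $B(x)$ is the closure of $U(x)$, i.e. $B(x)=\{y\in G : y\subset z \text{ for some } z\in G \text{ with } x\subset z\}$, and the unit sphere is $S(x)=B(x)\setminus U(x)$. -}

module Defs where

open import Data.Bool.Properties using () renaming (_≟_ to _≟ᵇ_)
open import Data.Fin.Subset using (Subset; Nonempty; _⊆_; ∣_∣)
open import Data.Fin.Subset.Properties using (_⊆?_)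
open import Data.Integer.Base using (ℤ; 0ℤ; -1ℤ; _+_; _^_)
open import Data.List.Base using (List; filter; foldr; map)
open import Data.List.Membership.Propositional using (_∈_)
open import Data.List.Relation.Unary.Any using (Any; any?)
open import Data.List.Relation.Unary.Unique.Propositional using (Unique)
open import Data.Nat.Base using (ℕ; _∸_)
open import Data.Product.Base using (_×_)
open import Data.Vec.Properties using (≡-dec)
open import Relation.Binary.Definitions using (DecidableEquality)
open import Relation.Nullary.Decidable using (Dec; ¬?; _×-dec_)

_≟ˢ_ : ∀ {n} → DecidableEquality (Subset n)
_≟ˢ_ = ≡-dec _≟ᵇ_

-- Vertices are labelled by Fin n; a label need not be a vertex of the complex.
-- The finite set of faces is a duplicate-free list, so summing over the list
-- is summing over the set.
record SimplicialComplex (n : ℕ) : Set where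
  field
    faces    : List (Subset n)
    unique   : Unique faces
    nonempty : ∀ {x} → x ∈ faces → Nonempty x
    closed   : ∀ {x y} → x ∈ faces → Nonempty y → y ⊆ x → y ∈ faces

∑ : ∀ {a} {A : Set a} → List A → (A → ℤ) → ℤ
∑ xs f = foldr _+_ 0ℤ (map f xs)

-- The truncated subtraction is exact on faces, since these are non-empty.
w : ∀ {n} → Subset n → ℤ
w x = -1ℤ ^ (∣ x ∣ ∸ 1)

wt : ∀ {n} → List (Subset n) → ℤ
wt A = ∑ A w

module _ {n : ℕ} (G : SimplicialComplex n) where
  open SimplicialComplex G
  open import Data.List.Membership.DecPropositional (_≟ˢ_ {n}) using (_∈?_)

  U : Subset n → List (Subset n)
  U x = filter (x ⊆?_) faces

  InBall : Subset n → Subset n → Set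
  InBall x y = Any (λ z → x ⊆ z × y ⊆ z) faces

  inBall? : ∀ x y → Dec (InBall x y)
  inBall? x y = any? (λ z → x ⊆? z ×-dec y ⊆? z) faces

  -- The closure of U x in the topology with basis the stars: y is in it iff
  -- its smallest neighbourhood U y meets U x, i.e. some face contains x and y.
  B : Subset n → List (Subset n)
  B x = filter (inBall? x) faces

  S : Subset n → List (Subset n)
  S x = filter (λ y → ¬? (y ∈? U x)) (B x)

{-# OPTIONS --safe #-}

-- Every unit ball has w (B x) = 1: fixing a vertex v of x, toggling v is a
-- sign-reversing involution of B x ∪ {∅}. The same argument gives
-- ∑ w z = 1 over the faces z ⊆ y, so ∑ₓ w x · w (U x), summed in the other
-- order, is ∑_y w y = ∑ₓ w x · w (B x). Since S x = B x ∖ U x, these cancel.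
module Submission where

open import Defs
open import Data.Nat.Base using (ℕ)
open import Data.Integer.Base using (0ℤ; _*_)
open import Relation.Binary.PropositionalEquality using (_≡_)

open import Algebra.Properties.CommutativeSemigroup using (interchange)
open import Data.Bool.Base using (not; true; false; if_then_else_)
open import Data.Bool.Properties using (not-involutive)
open import Data.Fin.Base using (Fin; zero; suc)
open import Data.Fin.Properties using () renaming (_≟_ to _≟ᶠ_)
open import Data.Fin.Subset using (Subset; Nonempty; _⊆_; ∣_∣; ⊥) renaming (_∈_ to _∈ˢ_)
open import Data.Fin.Subset.Properties using (_⊆?_; nonempty?; Empty-unique; ∉⊥; ⊥⊆)
open import Data.Integer.Base using (ℤ; 1ℤ; -1ℤ; _+_; -_; _^_)
open import Data.Integer.Properties using (+-assoc; +-inverseʳ; +-identityˡ; +-commutativeSemigroup; +-0-isCommutativeMonoid; *-zeroʳ; *-identityˡ; *-identityʳ; *-distribˡ-+; -1*i≡-i; neg-distrib-+; neg-distribʳ-*; neg-involutive)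
open import Data.Integer.Tactic.RingSolver using (solve-∀)
open import Data.List.Base using (List; []; _∷_; filter; foldr; map)
open import Data.List.Membership.Propositional using (_∈_; find; lose)
open import Data.List.Membership.Propositional.Properties using (∈-filter⁺; ∈-filter⁻; ∈-map⁺; ∈-map⁻)
open import Data.List.Membership.Propositional.Properties.WithK using (unique∧set⇒bag)
open import Data.List.Properties using (map-∘)
open import Data.List.Relation.Binary.BagAndSetEquality using (∼bag⇒↭)
open import Data.List.Relation.Binary.Permutation.Propositional using (_↭_; ↭⇒↭ₛ)
import Data.List.Relation.Binary.Permutation.Propositional.Properties as ↭
import Data.List.Relation.Binary.Permutation.Setoid.Properties as ↭ₛ
import Data.List.Relation.Unary.All as All
open import Data.List.Relation.Unary.AllPairs using (_∷_)
open import Data.List.Relation.Unary.Any using (here; there)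
open import Data.List.Relation.Unary.Unique.Propositional using (Unique)
import Data.List.Relation.Unary.Unique.Propositional.Properties as Unique
open import Data.Nat.Base using (suc)
open import Data.Product.Base using (_,_; proj₁; proj₂)
open import Data.Vec.Base using (_∷_; updateAt; there)
open import Data.Vec.Properties using (updateAt-updateAt; updateAt-id-local; updateAt-minimal)
open import Function.Base using (_∘_; id)
open import Function.Bundles using (mk⇔)
open import Relation.Nullary.Decidable using (Dec; does; yes; no; ¬?)
open import Relation.Unary using (Pred; Decidable)
import Relation.Binary.Definitions as B₂
open import Relation.Binary.Core using (REL)
open import Relation.Binary.PropositionalEquality using (refl; sym; trans; cong; cong₂; subst; setoid; module ≡-Reasoning)
open ≡-Reasoning

-- Finite sums over lists: reindexing, splitting, cancellation.

⟦_⟧ : ∀ {p} {P : Set p} → Dec P → ℤ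
⟦ d ⟧ = if does d then 1ℤ else 0ℤ

module _ {a} {A : Set a} where

  ∑-cong : ∀ (xs : List A) {f g : A → ℤ} → (∀ {x} → x ∈ xs → f x ≡ g x) → ∑ xs f ≡ ∑ xs g
  ∑-cong []       f≗g = refl
  ∑-cong (x ∷ xs) f≗g = cong₂ _+_ (f≗g (here refl)) (∑-cong xs (f≗g ∘ there))

  ∑-zero : ∀ (xs : List A) → ∑ xs (λ _ → 0ℤ) ≡ 0ℤ
  ∑-zero []       = refl
  ∑-zero (x ∷ xs) = trans (+-identityˡ _) (∑-zero xs)

  ∑-+ : ∀ (xs : List A) (f g : A → ℤ) → ∑ xs (λ x → f x + g x) ≡ ∑ xs f + ∑ xs g
  ∑-+ []       f g = refl
  ∑-+ (x ∷ xs) f g = trans (cong (f x + g x +_) (∑-+ xs f g))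
                           (interchange +-commutativeSemigroup (f x) (g x) _ _)

  ∑-*ˡ : ∀ (xs : List A) (c : ℤ) (f : A → ℤ) → ∑ xs (λ x → c * f x) ≡ c * ∑ xs f
  ∑-*ˡ []       c f = sym (*-zeroʳ c)
  ∑-*ˡ (x ∷ xs) c f = trans (cong (c * f x +_) (∑-*ˡ xs c f)) (sym (*-distribˡ-+ c (f x) _))

  ∑-neg : ∀ (xs : List A) (f : A → ℤ) → ∑ xs (λ x → - f x) ≡ - ∑ xs f
  ∑-neg []       f = refl
  ∑-neg (x ∷ xs) f = trans (cong (- f x +_) (∑-neg xs f)) (sym (neg-distrib-+ (f x) _))

  ∑-↭ : ∀ {xs ys : List A} (f : A → ℤ) → xs ↭ ys → ∑ xs f ≡ ∑ ys f
  ∑-↭ f xs↭ys = ↭ₛ.foldr-commMonoid (setoid ℤ) +-0-isCommutativeMonoid (↭⇒↭ₛ (↭.map⁺ f xs↭ys))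

  ∑-split : ∀ {p} {P : Pred A p} (P? : Decidable P) (f : A → ℤ) (xs : List A) →
            ∑ xs f ≡ ∑ (filter P? xs) f + ∑ (filter (¬? ∘ P?) xs) f
  ∑-split P? f [] = refl
  ∑-split P? f (x ∷ xs) with does (P? x)
  ... | true  = trans (cong (f x +_) (∑-split P? f xs)) (sym (+-assoc (f x) _ _))
  ... | false = trans (cong (f x +_) (∑-split P? f xs)) (swapˡ (f x) (∑ (filter P? xs) f) _)
    where
    swapˡ : ∀ i j k → i + (j + k) ≡ j + (i + k)
    swapˡ = solve-∀

  -- The Iverson bracket `⟦_⟧` moves the condition from the range into the summand, so that the
  -- range of an inner sum no longer depends on the outer variable.
  ∑-filter : ∀ {p} {P : Pred A p} (P? : Decidable P) (f : A → ℤ) (xs : List A) →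
             ∑ (filter P? xs) f ≡ ∑ xs (λ x → ⟦ P? x ⟧ * f x)
  ∑-filter P? f [] = refl
  ∑-filter P? f (x ∷ xs) with does (P? x)
  ... | true  = cong₂ _+_ (sym (*-identityˡ (f x))) (∑-filter P? f xs)
  ... | false = trans (∑-filter P? f xs) (sym (+-identityˡ _))

  -- Every multiplicity is at most one, so equality as sets is already equality as bags.
  unique-↭ : ∀ {xs ys : List A} → Unique xs → Unique ys →
             (∀ {x} → x ∈ xs → x ∈ ys) → (∀ {x} → x ∈ ys → x ∈ xs) → xs ↭ ys
  unique-↭ xs! ys! xs⊆ys ys⊆xs = ∼bag⇒↭ (unique∧set⇒bag xs! ys! (mk⇔ xs⊆ys ys⊆xs))

  -- `t` permutes `xs`, so reindexing by `t` shows that the sum equals its own negative, and an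
  -- integer with this property is zero.
  ∑-involution : ∀ {xs : List A} (t : A → A) (f : A → ℤ) → Unique xs →
                 (∀ x → t (t x) ≡ x) → (∀ {x} → x ∈ xs → t x ∈ xs) →
                 (∀ x → f (t x) ≡ - f x) → ∑ xs f ≡ 0ℤ
  ∑-involution {xs} t f xs! t∘t t-closed f∘t = i≡-i⇒i≡0 (∑ xs f) (begin
    ∑ xs f               ≡⟨ ∑-↭ f xs↭txs ⟩
    ∑ (map t xs) f       ≡⟨ cong (foldr _+_ 0ℤ) (sym (map-∘ xs)) ⟩
    ∑ xs (f ∘ t)         ≡⟨ ∑-cong xs (λ {x} _ → f∘t x) ⟩
    ∑ xs (λ x → - f x)   ≡⟨ ∑-neg xs f ⟩
    - ∑ xs f             ∎)
    where
    i≡-i⇒i≡0 : ∀ i → i ≡ - i → i ≡ 0ℤ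
    -- For nonzero `i` the two sides have different constructors, so those cases are absurd.
    i≡-i⇒i≡0 (ℤ.pos 0) _ = refl

    t-injective : ∀ {x y} → t x ≡ t y → x ≡ y
    t-injective {x} {y} tx≡ty = trans (sym (t∘t x)) (trans (cong t tx≡ty) (t∘t y))

    map⊆ : ∀ {y} → y ∈ map t xs → y ∈ xs
    map⊆ y∈ with ∈-map⁻ t y∈
    ... | _ , x∈ , refl = t-closed x∈

    xs↭txs : xs ↭ map t xs
    xs↭txs = unique-↭ xs! (Unique.map⁺ t-injective xs!)
      (λ {x} x∈ → subst (_∈ map t xs) (t∘t x) (∈-map⁺ t (t-closed x∈))) map⊆

module _ {a b} {A : Set a} {B : Set b} where

  ∑-swap : ∀ (xs : List A) (ys : List B) (f : A → B → ℤ) →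
           ∑ xs (λ x → ∑ ys (f x)) ≡ ∑ ys (λ y → ∑ xs (λ x → f x y))
  ∑-swap []       ys f = sym (∑-zero ys)
  ∑-swap (x ∷ xs) ys f = trans (cong (∑ ys (f x) +_) (∑-swap xs ys f)) (sym (∑-+ ys (f x) _))

  -- Both sides sum `f x * g y` over the pairs related by `R`, grouped by `x` on the left and by `y`
  -- on the right.
  ∑-filter-swap : ∀ {r} {R : REL A B r} (R? : B₂.Decidable R) (f : A → ℤ) (g : B → ℤ) xs ys →
                  ∑ xs (λ x → f x * ∑ (filter (R? x) ys) g) ≡
                  ∑ ys (λ y → g y * ∑ (filter (λ x → R? x y) xs) f)
  ∑-filter-swap R? f g xs ys = begin
    ∑ xs (λ x → f x * ∑ (filter (R? x) ys) g)
      ≡⟨ ∑-cong xs (λ {x} _ → expand ys (f x) (R? x) g) ⟩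
    ∑ xs (λ x → ∑ ys (λ y → f x * (⟦ R? x y ⟧ * g y)))
      ≡⟨ ∑-swap xs ys _ ⟩
    ∑ ys (λ y → ∑ xs (λ x → f x * (⟦ R? x y ⟧ * g y)))
      ≡⟨ ∑-cong ys (λ {y} _ → ∑-cong xs (λ {x} _ → flip (f x) ⟦ R? x y ⟧ (g y))) ⟩
    ∑ ys (λ y → ∑ xs (λ x → g y * (⟦ R? x y ⟧ * f x)))
      ≡⟨ ∑-cong ys (λ {y} _ → expand xs (g y) (λ x → R? x y) f) ⟨
    ∑ ys (λ y → g y * ∑ (filter (λ x → R? x y) xs) f) ∎
    where
    expand : ∀ {c p} {C : Set c} {P : Pred C p} (zs : List C) (k : ℤ) (P? : Decidable P) h →
             k * ∑ (filter P? zs) h ≡ ∑ zs (λ z → k * (⟦ P? z ⟧ * h z))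
    expand zs k P? h = trans (cong (k *_) (∑-filter P? h zs)) (sym (∑-*ˡ zs k _))

    flip : ∀ i j k → i * (j * k) ≡ k * (j * i)
    flip = solve-∀

-- Toggling a vertex, and the weight of a cone.

toggle : ∀ {n} → Fin n → Subset n → Subset n
toggle v x = updateAt x v not

toggle-involutive : ∀ {n} (v : Fin n) x → toggle v (toggle v x) ≡ x
toggle-involutive v x =
  trans (updateAt-updateAt v x) (updateAt-id-local v x (not-involutive _))

toggle-⊆ : ∀ {n} {v : Fin n} {x y} → v ∈ˢ y → x ⊆ y → toggle v x ⊆ y
toggle-⊆ {v = v} {x} {y} v∈y x⊆y {u} u∈tx with u ≟ᶠ v
... | yes refl = v∈y
-- `updateAt-minimal` carries membership of `u` forward through a toggle at `v`; toggling a second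
-- time therefore leads back to `x`.
... | no  u≢v  = x⊆y (subst (u ∈ˢ_) (toggle-involutive v x)
                        (updateAt-minimal u v (toggle v x) u≢v u∈tx))

-- Unlike `w`, whose truncated exponent gives the empty set and a singleton the same value, `sign`
-- also alternates between these two.
sign : ∀ {n} → Subset n → ℤ
sign x = -1ℤ ^ ∣ x ∣

sign-toggle : ∀ {n} (v : Fin n) x → sign (toggle v x) ≡ - sign x
sign-toggle zero    (true  ∷ x) = sym (trans (cong -_ (-1*i≡-i (sign x))) (neg-involutive _))
sign-toggle zero    (false ∷ x) = -1*i≡-i (sign x)
sign-toggle (suc v) (true  ∷ x) = trans (cong (-1ℤ *_) (sign-toggle v x)) (sym (neg-distribʳ-* -1ℤ _))
sign-toggle (suc v) (false ∷ x) = sign-toggle v x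

sign-⊥ : ∀ n → sign (⊥ {n}) ≡ 1ℤ
sign-⊥ 0       = refl
sign-⊥ (suc n) = sign-⊥ n

-- The recursion stops at the least element of `x`, where `∣ x ∣` becomes a successor and
-- `∣ x ∣ ∸ 1` computes exactly.
w≡-sign : ∀ {n} {x : Subset n} → Nonempty x → w x ≡ - sign x
w≡-sign {x = x} (v , v∈x) = go x v∈x
  where
  go : ∀ {n v} (x : Subset n) → v ∈ˢ x → w x ≡ - sign x
  go (true  ∷ x) _           = sym (trans (cong -_ (-1*i≡-i (sign x))) (neg-involutive _))
  go (false ∷ x) (there v∈x) = go x v∈x

-- For a simplicial complex `L` the last hypothesis says that `L` is a cone with apex `v`, and the
-- conclusion is that its Euler characteristic is 1. Toggling `v` may lead from the singleton of `v`
-- to `⊥`, so `⊥` is adjoined to make the involution total; the signs then cancel, and `⊥` alone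
-- accounts for the 1.
wt-cone : ∀ {n} (v : Fin n) {L : List (Subset n)} → Unique L →
          (∀ {y} → y ∈ L → Nonempty y) →
          (∀ {y} → y ∈ ⊥ ∷ L → Nonempty (toggle v y) → toggle v y ∈ L) →
          wt L ≡ 1ℤ
wt-cone {n} v {L} L! L-nonempty L-toggle = begin
  ∑ L w                      ≡⟨ ∑-cong L (w≡-sign ∘ L-nonempty) ⟩
  ∑ L (λ y → - sign y)       ≡⟨ ∑-neg L sign ⟩
  - ∑ L sign                 ≡⟨ rearrange 1ℤ (∑ L sign) ⟩
  1ℤ + - (1ℤ + ∑ L sign)     ≡⟨ cong (λ i → 1ℤ + - (i + ∑ L sign)) (sign-⊥ n) ⟨
  1ℤ + - ∑ (⊥ ∷ L) sign      ≡⟨ cong (λ i → 1ℤ + - i) ∑sign≡0 ⟩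
  1ℤ                         ∎
  where
  rearrange : ∀ i j → - j ≡ i + - (i + j)
  rearrange = solve-∀

  ⊥∷L! : Unique (⊥ ∷ L)
  ⊥∷L! = All.tabulate (λ { y∈L refl → ∉⊥ (proj₂ (L-nonempty y∈L)) }) ∷ L!

  ⊥∷L-toggle : ∀ {y} → y ∈ ⊥ ∷ L → toggle v y ∈ ⊥ ∷ L
  ⊥∷L-toggle {y} y∈ with nonempty? (toggle v y)
  ... | yes ne = there (L-toggle y∈ ne)
  ... | no  ¬ne = here (Empty-unique ¬ne)

  ∑sign≡0 : ∑ (⊥ ∷ L) sign ≡ 0ℤ
  ∑sign≡0 = ∑-involution (toggle v) sign ⊥∷L! (toggle-involutive v) ⊥∷L-toggle (sign-toggle v)

-- Weights of balls, closures, stars and spheres.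

module _ {n : ℕ} (G : SimplicialComplex n) where
  open SimplicialComplex G
  open import Data.List.Membership.DecPropositional (_≟ˢ_ {n}) using (_∈?_)

  wt-B : ∀ {x} → x ∈ faces → wt (B G x) ≡ 1ℤ
  wt-B {x} x∈G with nonempty x∈G
  ... | v , v∈x = wt-cone v (Unique.filter⁺ (inBall? G x) unique)
                    (nonempty ∘ proj₁ ∘ ∈-filter⁻ (inBall? G x))
                    (λ y∈ → toggle∈B (inBall y∈))
    where
    inBall : ∀ {y} → y ∈ ⊥ ∷ B G x → InBall G x y
    -- For the adjoined empty set, `x` itself is a face containing both.
    inBall (here refl) = lose x∈G (id , ⊥⊆)
    inBall (there y∈B) = proj₂ (∈-filter⁻ (inBall? G x) {xs = faces} y∈B)

    toggle∈B : ∀ {y} → InBall G x y → Nonempty (toggle v y) → toggle v y ∈ B G x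
    toggle∈B y∈B ne with find y∈B
    -- The same `z` witnesses that the toggled set is in the ball, because `v` lies in `x` and hence
    -- in `z`.
    ... | z , z∈G , x⊆z , y⊆z = ∈-filter⁺ (inBall? G x) (closed z∈G ne ty⊆z) (lose z∈G (x⊆z , ty⊆z))
      where ty⊆z = toggle-⊆ (x⊆z v∈x) y⊆z

  -- The list is the closure of the point `y`, a full simplex, which is a cone over any of its
  -- vertices.
  wt-closure : ∀ {y} → y ∈ faces → wt (filter (_⊆? y) faces) ≡ 1ℤ
  wt-closure {y} y∈G with nonempty y∈G
  ... | v , v∈y = wt-cone v (Unique.filter⁺ (_⊆? y) unique)
                    (nonempty ∘ proj₁ ∘ ∈-filter⁻ (_⊆? y))
                    (λ x∈ → toggle∈ (below x∈))
    where
    below : ∀ {x} → x ∈ ⊥ ∷ filter (_⊆? y) faces → x ⊆ y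
    below (here refl) = ⊥⊆
    below (there x∈)  = proj₂ (∈-filter⁻ (_⊆? y) {xs = faces} x∈)

    toggle∈ : ∀ {x} → x ⊆ y → Nonempty (toggle v x) → toggle v x ∈ filter (_⊆? y) faces
    toggle∈ x⊆y ne = ∈-filter⁺ (_⊆? y) (closed y∈G ne tx⊆y) tx⊆y
      where tx⊆y = toggle-⊆ v∈y x⊆y

  -- `S G x` is what remains of the ball outside the star, and the star lies inside the ball: if
  -- `x ⊆ y`, then `y` itself is a face containing both.
  wt-B-split : ∀ x → wt (B G x) ≡ wt (U G x) + wt (S G x)
  wt-B-split x = trans (∑-split (_∈? U G x) w (B G x)) (cong (_+ wt (S G x)) (∑-↭ w B∩U↭U))
    where
    U⊆B : ∀ {y} → y ∈ U G x → y ∈ B G x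
    U⊆B y∈U with ∈-filter⁻ (x ⊆?_) y∈U
    ... | y∈G , x⊆y = ∈-filter⁺ (inBall? G x) y∈G (lose y∈G (x⊆y , id))

    B∩U↭U : filter (_∈? U G x) (B G x) ↭ U G x
    B∩U↭U = unique-↭
      (Unique.filter⁺ (_∈? U G x) (Unique.filter⁺ (inBall? G x) unique))
      (Unique.filter⁺ (x ⊆?_) unique)
      (λ y∈ → proj₂ (∈-filter⁻ (_∈? U G x) {xs = B G x} y∈))
      (λ y∈U → ∈-filter⁺ (_∈? U G x) (U⊆B y∈U) y∈U)

  ∑-w*wt-U : ∑ faces (λ x → w x * wt (U G x)) ≡ ∑ faces w
  ∑-w*wt-U = begin
    -- Regroup the pairs `x ⊆ y`: the star of `x` collects the larger faces `y`, the closure of `y`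
    -- the smaller faces `x`.
    ∑ faces (λ x → w x * wt (U G x))                   ≡⟨ ∑-filter-swap _⊆?_ w w faces faces ⟩
    ∑ faces (λ y → w y * wt (filter (_⊆? y) faces))    ≡⟨ ∑-cong faces (λ {y} y∈G → trans (cong (w y *_) (wt-closure y∈G)) (*-identityʳ (w y))) ⟩
    ∑ faces w                                          ∎

  w*wt-S : ∀ {x} → x ∈ faces → w x * wt (S G x) ≡ w x + - (w x * wt (U G x))
  w*wt-S {x} x∈G = begin
    -- Add and subtract the star term, so that star and sphere combine to the ball, whose weight is
    -- 1.
    w x * wt (S G x)                                          ≡⟨ rearrange (w x) (wt (U G x)) _ ⟩
    w x * (wt (U G x) + wt (S G x)) + - (w x * wt (U G x))    ≡⟨ cong (λ i → w x * i + - (w x * wt (U G x))) (trans (sym (wt-B-split x)) (wt-B x∈G)) ⟩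
    w x * 1ℤ + - (w x * wt (U G x))                           ≡⟨ cong (_+ - (w x * wt (U G x))) (*-identityʳ (w x)) ⟩
    w x + - (w x * wt (U G x))                                ∎
    where
    rearrange : ∀ i j k → i * k ≡ i * (j + k) + - (i * j)
    rearrange = solve-∀

mainTheorem4 : (n : ℕ) (G : SimplicialComplex n) → ∑ (SimplicialComplex.faces G) (λ x → w x * wt (S G x)) ≡ 0ℤ
mainTheorem4 n G = begin
  ∑ faces (λ x → w x * wt (S G x))                    ≡⟨ ∑-cong faces (w*wt-S G) ⟩
  ∑ faces (λ x → w x + - (w x * wt (U G x)))          ≡⟨ ∑-+ faces w _ ⟩
  ∑ faces w + ∑ faces (λ x → - (w x * wt (U G x)))    ≡⟨ cong (∑ faces w +_) (∑-neg faces _) ⟩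
  ∑ faces w + - ∑ faces (λ x → w x * wt (U G x))      ≡⟨ cong (λ i → ∑ faces w + - i) (∑-w*wt-U G) ⟩
  ∑ faces w + - ∑ faces w                             ≡⟨ +-inverseʳ (∑ faces w) ⟩
  0ℤ                                                  ∎
  where open SimplicialComplex G
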